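{- The minimum number of monochromatic triangles in a line $2$-coloring of the Fano configuration, taken over all line $2$-colorings, is $4$.
   Context: A configuration is a pair $(\mathcal{P},\mathcal{L})$ with $\mathcal{P}$ a finite set of points and $\mathcal{L}$ a finite set of subsets of $\mathcal{P}$ called lines, such that any two distinct points lie together on at most one line, all points are on the same number of lines, all lines contain the same number of points, and there are at least three points. Three points $p_1,p_2,p_3$ form a triangle if there are lines $l_1,l_2,l_3$ with $p_1,p_2\in l_1$, $p_3\notin l_1$; $p_2,p_3\in l_2$, $p_1\notin l_2$; $p_1,p_3\in l_3$, $p_2\notin l_3$. The lines $l_1,l_2,l_3$ are then uniquely determined by the points. Triangles are counted as unordered triples of points, and need not be disjoint from each other. A line $2$-coloring assigns to each line one of the colors red, blue. A triangle is monochromatic if its lines $l_1,l_2,l_3$ all have the same color. The Fano configuration is the projective plane of order $2$: points $\mathbb{Z}/7$, lines $\{i,i+1,i+3\}$ for $i\in\mathbb{Z}/7$. -}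

module Defs where

open import Data.Fin.Base using (Fin; toℕ; _<_)
open import Data.Fin.Properties using (_≟_; _<?_; all?; any?)
open import Data.Fin.Subset using (Subset; _∈_; _∉_; ∣_∣; ⁅_⁆; _∪_)
open import Data.Fin.Subset.Properties using (_∈?_)
open import Data.List.Base
  using (List; length; filter; allFin; cartesianProduct)
open import Data.Nat.Base as ℕ using (ℕ; _≤_)
open import Data.Nat.DivMod using (_mod_)
import Data.Nat.Properties as ℕ
open import Data.Product.Base using (Σ; ∃; _×_; _,_)
open import Data.Vec.Base using (tabulate; lookup)
open import Data.Vec.Properties using (≡-dec)
import Data.Bool.Properties as Bool
open import Function.Definitions using (Injective)
open import Relation.Binary.Definitions using (DecidableEquality)
open import Relation.Binary.PropositionalEquality using (_≡_; _≢_; refl)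
open import Relation.Nullary.Decidable
  using (Dec; yes; no; ¬?; _×-dec_; _→-dec_; map′; from-yes)

linesThrough : ∀ {v b} → (Fin b → Subset v) → Fin v → Subset b
linesThrough line p = tabulate (λ l → lookup (line l) p)

-- The set of lines is presented as an injectively indexed family of subsets.
record Configuration : Set where
  field
    #points : ℕ
    #lines  : ℕ
    line    : Fin #lines → Subset #points

  Point : Set
  Point = Fin #points

  Line : Set
  Line = Fin #lines

  field
    line-injective : Injective _≡_ _≡_ line
    atMostOneLine  : ∀ p q → p ≢ q → ∀ l m →
                     p ∈ line l → q ∈ line l →
                     p ∈ line m → q ∈ line m → l ≡ m
    pointRegular   : ∀ p q → ∣ linesThrough line p ∣ ≡ ∣ linesThrough line q ∣
    lineUniform    : ∀ l m → ∣ line l ∣ ≡ ∣ line m ∣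
    threePoints    : 3 ≤ #points

data Color : Set where
  red blue : Color

_≟ᶜ_ : DecidableEquality Color
red  ≟ᶜ red  = yes refl
red  ≟ᶜ blue = no λ ()
blue ≟ᶜ red  = no λ ()
blue ≟ᶜ blue = yes refl

module _ (C : Configuration) where
  open Configuration C

  Coloring : Set
  Coloring = Line → Color

  JoinsAvoiding : Point → Point → Point → Line → Set
  JoinsAvoiding p q r l = p ∈ line l × q ∈ line l × r ∉ line l

  joinsAvoiding? : ∀ p q r l → Dec (JoinsAvoiding p q r l)
  joinsAvoiding? p q r l =
    (p ∈? line l) ×-dec (q ∈? line l) ×-dec ¬? (r ∈? line l)

  Triangle : Point → Point → Point → Set
  Triangle p₁ p₂ p₃ = ∃ (JoinsAvoiding p₁ p₂ p₃)
                    × ∃ (JoinsAvoiding p₂ p₃ p₁)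
                    × ∃ (JoinsAvoiding p₁ p₃ p₂)

  Monochromatic : Coloring → ∀ {p₁ p₂ p₃} → Triangle p₁ p₂ p₃ → Set
  Monochromatic c ((l₁ , _) , (l₂ , _) , (l₃ , _)) = c l₁ ≡ c l₂ × c l₂ ≡ c l₃

  MonochromaticTriangle : Coloring → Point × Point × Point → Set
  MonochromaticTriangle c (p₁ , p₂ , p₃) =
    Σ (Triangle p₁ p₂ p₃) (Monochromatic c)

  monochromaticTriangle? : ∀ c t → Dec (MonochromaticTriangle c t)
  monochromaticTriangle? c (p₁ , p₂ , p₃) = map′
    (λ { (l₁ , j₁ , l₂ , j₂ , l₃ , j₃ , e) →
         ((l₁ , j₁) , (l₂ , j₂) , (l₃ , j₃)) , e })
    (λ { (((l₁ , j₁) , (l₂ , j₂) , (l₃ , j₃)) , e) →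
         l₁ , j₁ , l₂ , j₂ , l₃ , j₃ , e })
    (any? λ l₁ → joinsAvoiding? p₁ p₂ p₃ l₁ ×-dec
     any? λ l₂ → joinsAvoiding? p₂ p₃ p₁ l₂ ×-dec
     any? λ l₃ → joinsAvoiding? p₁ p₃ p₂ l₃ ×-dec
     (c l₁ ≟ᶜ c l₂) ×-dec (c l₂ ≟ᶜ c l₃))

  -- Each set of three distinct points is listed once, in increasing order;
  -- being a (monochromatic) triangle does not depend on the order.
  unorderedTriples : List (Point × Point × Point)
  unorderedTriples =
    filter (λ { (p , q , r) → (p <? q) ×-dec (q <? r) })
      (cartesianProduct (allFin #points)
        (cartesianProduct (allFin #points) (allFin #points)))

  #monochromaticTriangles : Coloring → ℕ
  #monochromaticTriangles c =
    length (filter (monochromaticTriangle? c) unorderedTriples)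

fanoLine : Fin 7 → Subset 7
fanoLine i = ⁅ i ⁆ ∪ ⁅ (toℕ i ℕ.+ 1) mod 7 ⁆ ∪ ⁅ (toℕ i ℕ.+ 3) mod 7 ⁆

fano : Configuration
fano = record
  { #points        = 7
  ; #lines         = 7
  ; line           = fanoLine
  ; line-injective = λ {l} {m} → injective l m
  ; atMostOneLine  = from-yes (all? λ p → all? λ q → ¬? (p ≟ q) →-dec
      (all? λ l → all? λ m →
        (p ∈? fanoLine l) →-dec (q ∈? fanoLine l) →-dec
        (p ∈? fanoLine m) →-dec (q ∈? fanoLine m) →-dec (l ≟ m)))
  ; pointRegular   = from-yes (all? λ p → all? λ q →
      ∣ linesThrough fanoLine p ∣ ℕ.≟ ∣ linesThrough fanoLine q ∣)
  ; lineUniform    = from-yes (all? λ l → all? λ m →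
      ∣ fanoLine l ∣ ℕ.≟ ∣ fanoLine m ∣)
  ; threePoints    = from-yes (3 ℕ.≤? 7)
  }
  where
  injective : ∀ l m → fanoLine l ≡ fanoLine m → l ≡ m
  injective = from-yes (all? λ l → all? λ m →
    ≡-dec Bool._≟_ (fanoLine l) (fanoLine m) →-dec (l ≟ m))

-- "The minimum value of f is k", including that it is attained.
IsMinimum : {A : Set} → (A → ℕ) → ℕ → Set
IsMinimum f k = ∃ (λ a → f a ≡ k) × (∀ a → k ≤ f a)

{-# OPTIONS --safe #-}
module Submission where

open import Data.List.Base using (length)
open import Data.List.Properties using (filter-≐)
open import Data.Nat.Base using (zero; suc; _≤_)
open import Data.Nat.Properties using (_≤?_)
open import Data.Product.Base using (_,_)
open import Data.Vec.Base using (Vec; []; _∷_; lookup; tabulate)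
open import Data.Vec.Properties using (lookup∘tabulate)
open import Relation.Binary.PropositionalEquality
  using (_≡_; _≗_; refl; sym; trans; cong; subst)
open import Relation.Nullary.Decidable
  using (Dec; _×-dec_; map′; from-yes)

open import Defs

-- Any two Fano lines meet, so triangles are triples of nonconcurrent lines. With r red lines,
-- r(7-r)/2 points are on lines of both colors, leaving C(r,3) + C(7-r,3) - 7 + r(7-r)/2
-- monochromatic triangles, least for r = 3 or 4. The proof instead evaluates all 128 colorings,
-- coded as vectors.

allColors? : {P : Color → Set} → (∀ x → Dec (P x)) → Dec (∀ x → P x)
allColors? P? = map′
  (λ { (r , b) → λ { red → r ; blue → b } })
  (λ f → f red , f blue)
  (P? red ×-dec P? blue)

allColorVecs? : ∀ {n} {P : Vec Color n → Set} →
                (∀ v → Dec (P v)) → Dec (∀ v → P v)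
allColorVecs? {zero}  P? = map′ (λ { p [] → p }) (λ f → f []) (P? [])
allColorVecs? {suc n} P? = map′
  (λ { f (x ∷ v) → f x v })
  (λ f x v → f (x ∷ v))
  (allColors? λ x → allColorVecs? λ v → P? (x ∷ v))

monochromaticTriangle-resp-≗ : ∀ C {c d : Coloring C} → c ≗ d → ∀ {t} →
  MonochromaticTriangle C c t → MonochromaticTriangle C d t
monochromaticTriangle-resp-≗ C c≗d (t@((l₁ , _) , (l₂ , _) , (l₃ , _)) , e₁₂ , e₂₃) =
  t , trans (sym (c≗d l₁)) (trans e₁₂ (c≗d l₂))
    , trans (sym (c≗d l₂)) (trans e₂₃ (c≗d l₃))

-- Carries the bound from vectors to arbitrary colorings: `c` agrees with `lookup (tabulate c)` only
-- pointwise, and without function extensionality the count must be shown to respect this.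
#monochromaticTriangles-cong : ∀ C {c d : Coloring C} → c ≗ d →
  #monochromaticTriangles C c ≡ #monochromaticTriangles C d
#monochromaticTriangles-cong C {c} {d} c≗d = cong length
  (filter-≐ (monochromaticTriangle? C c) (monochromaticTriangle? C d)
    ( (λ {t} → monochromaticTriangle-resp-≗ C c≗d {t})
    , (λ {t} → monochromaticTriangle-resp-≗ C (λ l → sym (c≗d l)) {t}))
    (unorderedTriples C))

4≤#monochromaticTriangles : ∀ v → 4 ≤ #monochromaticTriangles fano (lookup v)
4≤#monochromaticTriangles =
  -- The type checker runs the search over all 2^7 vectors here.
  from-yes (allColorVecs? λ v → 4 ≤? #monochromaticTriangles fano (lookup v))

-- The red lines 0, 4 and 6 are the three lines through the point 0; no three
-- of the remaining four lines are concurrent, so every three form a triangle.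
extremalColoring : Coloring fano
extremalColoring = lookup
  (red ∷ blue ∷ blue ∷ blue ∷ red ∷ blue ∷ red ∷ [])

theorem4p1 : IsMinimum (#monochromaticTriangles fano) 4
theorem4p1 =
    (extremalColoring , refl)
  , λ c → subst (4 ≤_)
      (#monochromaticTriangles-cong fano (lookup∘tabulate c))
      (4≤#monochromaticTriangles (tabulate c))
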